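{- $\mathrm{ex}_<(n,C_4^{1243})=O(n^{3/2}\log n)$.
   Context: Edge-ordered graph: finite simple graph with a linear order on its edges; isomorphisms preserve order; subgraphs carry induced order; $\mathrm{ex}_<(n,H)$ is the maximum number of edges of an edge-ordered graph on $n$ vertices with no subgraph isomorphic to $H$. $C_4^{1243}$ is the 4-cycle $abcd$ whose edges $ab,bc,cd,da$ receive labels $1,2,4,3$ respectively, ordered by label (i.e. $ab<bc<da<cd$). -}

module Defs where

open import Data.Nat using (ℕ; _<_; _≤_; _*_; _^_)
open import Data.Fin using (Fin; toℕ)
open import Data.Product using (_×_; _,_; ∃; ∃-syntax)
open import Data.Sum using (_⊎_)
open import Data.List using (List; length; lookup)
open import Data.List.Relation.Unary.All using (All)
open import Data.List.Relation.Unary.Unique.Propositional using (Unique)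
open import Relation.Binary.PropositionalEquality using (_≡_; _≢_)

-- An edge on vertex set Fin n is stored as a pair (u , v) with u < v,
-- so each unordered pair {u,v} has exactly one representation.
Edge : ℕ → Set
Edge n = Fin n × Fin n

WellFormed : ∀ {n} → Edge n → Set
WellFormed (u , v) = toℕ u < toℕ v

-- An edge-ordered (finite simple) graph on n vertices: a duplicate-free list
-- of edges; the linear order on the edges is the order of the list
-- (earlier position = smaller edge).
record EdgeOrderedGraph (n : ℕ) : Set where
  field
    edges  : List (Edge n)
    proper : All WellFormed edges
    unique : Unique edges

open EdgeOrderedGraph public

∣E∣ : ∀ {n} → EdgeOrderedGraph n → ℕ
∣E∣ G = length (edges G)

Joins : ∀ {n} → Edge n → Fin n → Fin n → Set
Joins (u , v) x y = (u ≡ x × v ≡ y) ⊎ (u ≡ y × v ≡ x)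

Pos : ∀ {n} → EdgeOrderedGraph n → Set
Pos G = Fin (length (edges G))

_<ᵖ_ : ∀ {n} {G : EdgeOrderedGraph n} → Pos G → Pos G → Set
i <ᵖ j = toℕ i < toℕ j

-- G contains a copy of C₄^{1243}: the 4-cycle abcd with edges
-- ab, bc, cd, da labelled 1, 2, 4, 3, i.e. ab < bc < da < cd.
-- A copy is given by four distinct vertices a b c d of G and the positions
-- of the edges ab, bc, cd, da in G's edge order.
ContainsC4-1243 : ∀ {n} → EdgeOrderedGraph n → Set
ContainsC4-1243 {n} G =
  ∃[ a ] ∃[ b ] ∃[ c ] ∃[ d ]
    (a ≢ b × a ≢ c × a ≢ d × b ≢ c × b ≢ d × c ≢ d) ×
  ∃[ iab ] ∃[ ibc ] ∃[ icd ] ∃[ ida ]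
    (Joins (lookup (edges G) iab) a b ×
     Joins (lookup (edges G) ibc) b c ×
     Joins (lookup (edges G) icd) c d ×
     Joins (lookup (edges G) ida) d a ×
     _<ᵖ_ {G = G} iab ibc × _<ᵖ_ {G = G} ibc ida × _<ᵖ_ {G = G} ida icd)

{-# OPTIONS --safe #-}
module Submission where

-- Write T(ab) for the position of the edge ab. A 4-cycle abcd is a copy of
-- C₄^{1243} exactly when its first and last edges are opposite. Fix a ≠ c and call
-- a common neighbour b of a and c "up" if T(ab) < T(cb), "down" otherwise. If b and
-- d are both up or both down, then a and c meet b and d in opposite orders.
--
-- Fix a level s and cut the time axis into dyadic blocks of length 2^s. Let
-- φ_a(b,d) be the sign of T(ad) − T(ab) if both edges lie in the same block, and 0
-- otherwise. Expanding Σ_{b,d} (Σ_a φ_a(b,d))² ≥ 0 gives a sum over pairs (a,c). In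
-- the term of (a,c) with a ≠ c, group the common neighbours b by the pair of blocks
-- of ab and cb. A group with k ups and l downs contributes at most
-- (k + l) − (k − l)². The common neighbours b for which ab and cb lie in the left
-- and the right half of one block of length 2^(s+1) are all up and, again since G
-- is C₄^{1243}-free, form a single group. If N_s(a,c) is their number, then
-- Σ_{a,c} N_s(a,c)² ≤ 2S with S = Σ_b deg(b)².
--
-- Every up neighbour is counted by N_s for some of the O(log n) levels s, hence
-- S ≤ 2 Σ_{a,c,s} N_s(a,c) + Σ_b deg(b), and the Cauchy–Schwarz inequality yields
-- S = O(n² log² n) and |E|² ≤ n S. The argument follows the Marcus–Tardos bound for
-- intersection reverse sequences.

open import Defs
open import Data.Fin as Fin using (Fin; zero; suc; toℕ; fromℕ<; combine)
import Data.Fin.Properties as Finₚ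
open import Data.Integer as ℤ using (ℤ; +_)
import Data.Integer.Properties as ℤₚ
open import Data.List using (List; _∷_; lookup)
open import Data.List.Membership.Propositional.Properties using (∈-lookup)
import Data.List.Relation.Unary.All as All
open import Data.List.Relation.Unary.AllPairs using (_∷_)
open import Data.List.Relation.Unary.Unique.Propositional using (Unique)
open import Data.Maybe using (Maybe; just; nothing)
open import Data.Nat as ℕ using (ℕ; zero; suc; z≤n; s≤s; ⌊_/2⌋)
open import Data.Nat.Logarithm using (⌊log₂_⌋; ⌊log₂⌋-mono-≤; ⌊log₂[2^n]⌋≡n)
import Data.Nat.Properties as ℕₚ
import Data.Nat.Tactic.RingSolver as ℕ-Solver
open import Data.Product using (_×_; _,_; ∃-syntax; proj₁; proj₂)
open import Data.Sum using (inj₁; inj₂; swap)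
open import Relation.Binary using (Tri; tri<; tri≈; tri>)
open import Relation.Binary.PropositionalEquality using (_≡_; _≢_; refl; sym; trans; cong; cong₂; subst; subst₂; ≢-sym; module ≡-Reasoning)
open import Relation.Nullary using (¬_; Dec; yes; no; contradiction; _×-dec_; _⊎-dec_)

private variable
  k l m n : ℕ

module ℤ-Counting where
  open import Algebra.Properties.Semiring.Sum ℤₚ.+-*-semiring using (sum; sum-syntax; ∑-comm; ∑-distrib-+; sum-cong-≗; *-distribˡ-sum; *-distribʳ-sum)
  open import Data.Integer using (+0; -[1+_]; _+_; _*_; _-_; _≤_; +≤+; -≤+; 0ℤ; 1ℤ; -1ℤ; nonNegative)
  open import Data.Integer.Tactic.RingSolver using (solve-∀)

  -- Finite integer sums, Gram matrices and the Cauchy-Schwarz inequality.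

  ∑-mono-≤ : {f g : Fin n → ℤ} → (∀ i → f i ≤ g i) → ∑[ i < n ] f i ≤ ∑[ i < n ] g i
  ∑-mono-≤ {zero}  f≤g = ℤₚ.≤-refl
  ∑-mono-≤ {suc n} f≤g = ℤₚ.+-mono-≤ (f≤g zero) (∑-mono-≤ (λ i → f≤g (suc i)))

  ∑-const : ∀ n x → ∑[ i < n ] x ≡ + n * x
  ∑-const zero    x = sym (ℤₚ.*-zeroˡ x)
  ∑-const (suc n) x = trans (cong (_+_ x) (∑-const n x)) (sym (ℤₚ.suc-* (+ n) x))

  ∑-nonNeg : {f : Fin n → ℤ} → (∀ i → 0ℤ ≤ f i) → 0ℤ ≤ ∑[ i < n ] f i
  ∑-nonNeg {zero}  0≤f = ℤₚ.≤-refl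
  ∑-nonNeg {suc n} 0≤f = ℤₚ.+-mono-≤ (0≤f zero) (∑-nonNeg (λ i → 0≤f (suc i)))

  ∑-*-∑ : (f : Fin n → ℤ) (g : Fin k → ℤ) → sum f * sum g ≡ ∑[ i < n ] ∑[ j < k ] (f i * g j)
  ∑-*-∑ f g = trans (*-distribʳ-sum (sum g) f) (sum-cong-≗ (λ i → *-distribˡ-sum (f i) g))

  ∑-rotate : (F : Fin n → Fin k → Fin l → ℤ) →
    ∑[ i < n ] ∑[ j < k ] ∑[ h < l ] F i j h ≡ ∑[ h < l ] ∑[ i < n ] ∑[ j < k ] F i j h
  ∑-rotate F = trans (sum-cong-≗ (λ i → ∑-comm (F i))) (∑-comm (λ i h → sum (λ j → F i j h)))

  0≤i*i : ∀ i → 0ℤ ≤ i * i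
  0≤i*i +0         = +≤+ z≤n
  0≤i*i (+ suc n)  = +≤+ z≤n
  0≤i*i -[1+ n ]   = +≤+ z≤n

  gram : (u : Fin n → Fin k → ℤ) →
    ∑[ i < n ] ∑[ j < n ] ∑[ h < k ] (u i h * u j h) ≡
    ∑[ h < k ] (∑[ i < n ] u i h * ∑[ i < n ] u i h)
  gram u = trans (∑-rotate (λ i j h → u i h * u j h))
                 (sum-cong-≗ (λ h → sym (∑-*-∑ (λ i → u i h) (λ i → u i h))))

  -- The sum of all entries of a Gram matrix is a sum of squares of column sums. Both nonnegativity
  -- arguments below reduce to this.
  gram-nonNeg : (u : Fin n → Fin k → ℤ) → 0ℤ ≤ ∑[ i < n ] ∑[ j < n ] ∑[ h < k ] (u i h * u j h)
  gram-nonNeg u = subst (0ℤ ≤_) (sym (gram u)) (∑-nonNeg (λ h → 0≤i*i (sum (λ i → u i h))))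

  -- This expansion supplies the inductive step of Cauchy-Schwarz: since the left side is
  -- nonnegative, it bounds the mixed term `x * sum f + x * sum f` that a new entry `x` creates.
  ∑-square-dist : (x : ℤ) (f : Fin n → ℤ) →
    ∑[ i < n ] ((x - f i) * (x - f i)) ≡ + n * (x * x) - (x * sum f + x * sum f) + ∑[ i < n ] (f i * f i)
  ∑-square-dist {zero}  x f = base x
    where
    base : ∀ x → 0ℤ ≡ 0ℤ * (x * x) - (x * 0ℤ + x * 0ℤ) + 0ℤ
    base = solve-∀
  ∑-square-dist {suc n} x f = trans
    (cong (_+_ ((x - f zero) * (x - f zero))) (∑-square-dist x (λ i → f (suc i))))
    (step x (f zero) (sum (λ i → f (suc i))) (sum (λ i → f (suc i) * f (suc i))) (+ n))
    where
    step : ∀ x y r q k → (x - y) * (x - y) + (k * (x * x) - (x * r + x * r) + q) ≡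
      (1ℤ + k) * (x * x) - (x * (y + r) + x * (y + r)) + (y * y + q)
    step = solve-∀

  cauchy-schwarz : (f : Fin n → ℤ) → sum f * sum f ≤ + n * ∑[ i < n ] (f i * f i)
  cauchy-schwarz {zero}  f = ℤₚ.≤-refl
  cauchy-schwarz {suc n} f = begin
    (x + r) * (x + r)                                   ≡⟨ expand x r ⟩
    x * x + (x * r + x * r) + r * r                     ≤⟨ ℤₚ.+-monoʳ-≤ (x * x + (x * r + x * r)) (cauchy-schwarz (λ i → f (suc i))) ⟩
    x * x + (x * r + x * r) + + n * q                   ≡⟨ ℤₚ.+-identityʳ _ ⟨
    x * x + (x * r + x * r) + + n * q + 0ℤ              ≤⟨ ℤₚ.+-monoʳ-≤ (x * x + (x * r + x * r) + + n * q) 0≤dist ⟩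
    x * x + (x * r + x * r) + + n * q
      + (+ n * (x * x) - (x * r + x * r) + q)           ≡⟨ collect x r q (+ n) ⟩
    (1ℤ + + n) * (x * x + q)                            ∎
    where
    open ℤₚ.≤-Reasoning
    x = f zero
    r = sum (λ i → f (suc i))
    q = sum (λ i → f (suc i) * f (suc i))
    0≤dist : 0ℤ ≤ + n * (x * x) - (x * r + x * r) + q
    0≤dist = subst (0ℤ ≤_) (∑-square-dist x (λ i → f (suc i))) (∑-nonNeg (λ i → 0≤i*i (x - f (suc i))))
    expand : ∀ x r → (x + r) * (x + r) ≡ x * x + (x * r + x * r) + r * r
    expand = solve-∀
    collect : ∀ x r q k → x * x + (x * r + x * r) + k * q + (k * (x * x) - (x * r + x * r) + q) ≡
      (1ℤ + k) * (x * x + q)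
    collect = solve-∀

  -- Indicators, the Kronecker delta and kernels given by keys.

  ⟦_⟧ : ∀ {p} {P : Set p} → Dec P → ℤ
  ⟦ yes _ ⟧ = 1ℤ
  ⟦ no  _ ⟧ = 0ℤ

  ⟦⟧-true : ∀ {p} {P : Set p} (P? : Dec P) → P → ⟦ P? ⟧ ≡ 1ℤ
  ⟦⟧-true (yes _) _ = refl
  ⟦⟧-true (no ¬p) p = contradiction p ¬p

  ⟦⟧-false : ∀ {p} {P : Set p} (P? : Dec P) → ¬ P → ⟦ P? ⟧ ≡ 0ℤ
  ⟦⟧-false (yes p) ¬p = contradiction p ¬p
  ⟦⟧-false (no _)  _  = refl

  ⟦⟧-cong : ∀ {p q} {P : Set p} {Q : Set q} (P? : Dec P) (Q? : Dec Q) → (P → Q) → (Q → P) → ⟦ P? ⟧ ≡ ⟦ Q? ⟧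
  ⟦⟧-cong (yes p) Q? to from = sym (⟦⟧-true Q? (to p))
  ⟦⟧-cong (no ¬p) Q? to from = sym (⟦⟧-false Q? (λ q → ¬p (from q)))

  ⟦⟧-nonNeg : ∀ {p} {P : Set p} (P? : Dec P) → 0ℤ ≤ ⟦ P? ⟧
  ⟦⟧-nonNeg (yes _) = +≤+ z≤n
  ⟦⟧-nonNeg (no _)  = +≤+ z≤n

  δ : Fin n → Fin n → ℤ
  δ i j = ⟦ i Finₚ.≟ j ⟧

  ∑-zero : (f : Fin n → ℤ) → (∀ i → f i ≡ 0ℤ) → sum f ≡ 0ℤ
  ∑-zero {n} f f≡0 = trans (sum-cong-≗ f≡0) (trans (∑-const n 0ℤ) (ℤₚ.*-zeroʳ (+ n)))

  ∑-δ : (i : Fin n) (g : Fin n → ℤ) → ∑[ j < n ] (δ i j * g j) ≡ g i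
  ∑-δ zero g = trans
    (cong₂ _+_ (ℤₚ.*-identityˡ (g zero)) (∑-zero (λ j → δ zero (suc j) * g (suc j)) (λ j → ℤₚ.*-zeroˡ (g (suc j)))))
    (ℤₚ.+-identityʳ (g zero))
  ∑-δ (suc i) g = trans
    (cong₂ _+_ (ℤₚ.*-zeroˡ (g zero)) (sum-cong-≗ (λ j → cong (_* g (suc j))
      (⟦⟧-cong (suc i Finₚ.≟ suc j) (i Finₚ.≟ j) Finₚ.suc-injective (cong suc)))))
    (trans (ℤₚ.+-identityˡ _) (∑-δ i (λ j → g (suc j))))

  δ-comm : (i j : Fin n) → δ i j ≡ δ j i
  δ-comm i j = ⟦⟧-cong (i Finₚ.≟ j) (j Finₚ.≟ i) sym sym

  -- Grouping the indices by key turns the double sum into the sum over keys `z` of the squared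
  -- total of `τ` over the indices with key `z`. This is the Gram sum of the vectors
  -- `δ (κ i) z * τ i`.
  key-kernel-nonNeg : (κ : Fin n → Fin k) (τ : Fin n → ℤ) →
    0ℤ ≤ ∑[ i < n ] ∑[ j < n ] (δ (κ i) (κ j) * (τ i * τ j))
  key-kernel-nonNeg κ τ = subst (0ℤ ≤_)
    (sum-cong-≗ (λ i → sum-cong-≗ (λ j → by-key i j)))
    (gram-nonNeg (λ i z → δ (κ i) z * τ i))
    where
    regroup : ∀ p q s t → (p * s) * (q * t) ≡ p * (q * (s * t))
    regroup = solve-∀
    by-key : ∀ i j → sum (λ z → (δ (κ i) z * τ i) * (δ (κ j) z * τ j)) ≡ δ (κ i) (κ j) * (τ i * τ j)
    by-key i j = trans
      (sum-cong-≗ (λ z → regroup (δ (κ i) z) (δ (κ j) z) (τ i) (τ j)))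
      (trans (∑-δ (κ i) (λ z → δ (κ j) z * (τ i * τ j)))
             (cong (_* (τ i * τ j)) (δ-comm (κ j) (κ i))))

  -- Dyadic blocks of times.

  half : Fin m → Fin m
  half x = fromℕ< (ℕₚ.≤-<-trans (ℕₚ.⌊n/2⌋≤n (toℕ x)) (Finₚ.toℕ<n x))

  toℕ-half : (x : Fin m) → toℕ (half x) ≡ ⌊ toℕ x /2⌋
  toℕ-half x = Finₚ.toℕ-fromℕ< _

  half-mono-≤ : {x y : Fin m} → x Fin.≤ y → half x Fin.≤ half y
  half-mono-≤ {x = x} {y} x≤y = subst₂ ℕ._≤_ (sym (toℕ-half x)) (sym (toℕ-half y)) (ℕₚ.⌊n/2⌋-mono x≤y)

  half-cancel-< : {x y : Fin m} → half x Fin.< half y → x Fin.< y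
  half-cancel-< hx<hy = ℕₚ.≰⇒> (λ y≤x → ℕₚ.<⇒≱ hx<hy (half-mono-≤ y≤x))

  -- This is the floor of x / 2^s. It stays in `Fin m` so that block indices of all levels have one
  -- type.
  block : ℕ → Fin m → Fin m
  block zero    x = x
  block (suc s) x = block s (half x)

  block-cancel-< : ∀ s {x y : Fin m} → block s x Fin.< block s y → x Fin.< y
  block-cancel-< zero    x<y = x<y
  block-cancel-< (suc s) x<y = half-cancel-< (block-cancel-< s x<y)

  -- Only 2h and 2h + 1 have half h, so the smaller number is the even one and the larger is its
  -- successor. Hence the common half determines both.
  siblings : ∀ {u v} → u ℕ.< v → ⌊ u /2⌋ ≡ ⌊ v /2⌋ → u ≡ ⌊ u /2⌋ ℕ.+ ⌊ u /2⌋ × v ≡ suc u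
  siblings {zero}        {suc zero}    _ _ = refl , refl
  siblings {suc zero}    {suc zero}    (s≤s ()) _
  siblings {suc (suc u)} {suc (suc v)} (s≤s (s≤s u<v)) eq with siblings u<v (ℕₚ.suc-injective eq)
  ... | u≡ , v≡ = cong suc (trans (cong suc u≡) (sym (ℕₚ.+-suc _ _))) , cong (λ w → suc (suc w)) v≡

  siblings-unique : {u v u′ v′ : Fin m} → u Fin.< v → half u ≡ half v → u′ Fin.< v′ → half u′ ≡ half v′ →
    half u ≡ half u′ → u ≡ u′ × v ≡ v′
  siblings-unique {u = u} {v} {u′} {v′} u<v hu≡hv u′<v′ hu′≡hv′ hu≡hu′ =
    Finₚ.toℕ-injective u≡u′ , Finₚ.toℕ-injective (trans (proj₂ s) (trans (cong suc u≡u′) (sym (proj₂ s′))))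
    where
    halves : (x y : Fin _) → half x ≡ half y → ⌊ toℕ x /2⌋ ≡ ⌊ toℕ y /2⌋
    halves x y eq = trans (sym (toℕ-half x)) (trans (cong toℕ eq) (toℕ-half y))
    s  = siblings u<v (halves u v hu≡hv)
    s′ = siblings u′<v′ (halves u′ v′ hu′≡hv′)
    u≡u′ = trans (proj₁ s) (trans (cong (λ h → h ℕ.+ h) (halves u u′ hu≡hu′)) (sym (proj₁ s′)))

  -- x and y lie in the left and the right half of one dyadic block of length 2^(s+1).
  Split : ℕ → Fin m → Fin m → Set
  Split s x y = block s x Fin.< block s y × half (block s x) ≡ half (block s y)

  split? : ∀ s (x y : Fin m) → Dec (Split s x y)
  split? s x y = (block s x Finₚ.<? block s y) ×-dec (half (block s x) Finₚ.≟ half (block s y))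

  Split⇒< : ∀ s {x y : Fin m} → Split s x y → x Fin.< y
  Split⇒< s (bx<by , _) = block-cancel-< s bx<by

  half-< : ∀ l (x : Fin m) → toℕ x ℕ.< 2 ℕ.^ suc l → toℕ (half x) ℕ.< 2 ℕ.^ l
  half-< l x x< = subst (ℕ._< 2 ℕ.^ l) (sym (toℕ-half x))
    (ℕₚ.*-cancelˡ-< 2 _ _ (ℕₚ.≤-<-trans 2h≤x x<))
    where
    open ℕₚ.≤-Reasoning
    h = ⌊ toℕ x /2⌋
    2h≤x : 2 ℕ.* h ℕ.≤ toℕ x
    2h≤x = begin
      h ℕ.+ (h ℕ.+ 0)           ≡⟨ cong (h ℕ.+_) (ℕₚ.+-identityʳ h) ⟩
      h ℕ.+ h                   ≤⟨ ℕₚ.+-monoʳ-≤ h (ℕₚ.⌊n/2⌋≤⌈n/2⌉ (toℕ x)) ⟩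
      h ℕ.+ ℕ.⌈ toℕ x /2⌉       ≡⟨ ℕₚ.⌊n/2⌋+⌈n/2⌉≡n (toℕ x) ⟩
      toℕ x                     ∎

  -- Halve both times until they first share a half; the level just before is the one sought. It is
  -- smaller than `l`, because `l` halvings send every number below 2^l to 0.
  splitting-level : ∀ l (x y : Fin m) → toℕ y ℕ.< 2 ℕ.^ l → x Fin.< y → ∃[ s ] Split (toℕ {l} s) x y
  splitting-level zero    x y y<1 x<y = contradiction x<y (ℕₚ.<⇒≱ (ℕₚ.<-≤-trans y<1 (s≤s z≤n)))
  splitting-level (suc l) x y y< x<y with Finₚ.<-cmp (half x) (half y)
  ... | tri≈ _ hx≡hy _ = zero , x<y , hx≡hy
  ... | tri> _ _ hy<hx = contradiction (half-mono-≤ (ℕₚ.<⇒≤ x<y)) (ℕₚ.<⇒≱ hy<hx)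
  ... | tri< hx<hy _ _ with splitting-level l (half x) (half y) (half-< l y y<) hx<hy
  ...   | s , split = suc s , split

  -- x, y, x′, y′ are the times of ab, cb, ad, cd: the first edge ab is opposite to the last edge cd.
  Extremal : Fin m → Fin m → Fin m → Fin m → Set
  Extremal x y x′ y′ = x Fin.< y × x Fin.< x′ × y Fin.< y′ × x′ Fin.< y′

  -- If the two parent blocks differ, one pair of times lies wholly before the other, and two
  -- increasing pairs in this position are `Extremal`. If the parents agree, so do their left halves
  -- and their right halves.
  Split-unique : ∀ s {x y x′ y′ : Fin m} → ¬ Extremal x y x′ y′ → ¬ Extremal x′ y′ x y →
    Split s x y → Split s x′ y′ → block s x ≡ block s x′ × block s y ≡ block s y′
  Split-unique s {x} {y} {x′} {y′} ¬e ¬e′ sp@(u<v , hu≡hv) sp′@(u′<v′ , hu′≡hv′)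
    with Finₚ.<-cmp (half (block s x)) (half (block s x′))
  ... | tri≈ _ hu≡hu′ _ = siblings-unique u<v hu≡hv u′<v′ hu′≡hv′ hu≡hu′
  ... | tri< hu<hu′ _ _ = contradiction (x<y , ℕₚ.<-trans x<y y<x′ , ℕₚ.<-trans y<x′ x′<y′ , x′<y′) ¬e
    where
    x<y = Split⇒< s sp
    x′<y′ = Split⇒< s sp′
    y<x′ = block-cancel-< s (half-cancel-< (subst (Fin._< half (block s x′)) hu≡hv hu<hu′))
  ... | tri> _ _ hu′<hu = contradiction (x′<y′ , ℕₚ.<-trans x′<y′ y′<x , ℕₚ.<-trans y′<x x<y , x<y) ¬e′
    where
    x<y = Split⇒< s sp
    x′<y′ = Split⇒< s sp′
    y′<x = block-cancel-< s (half-cancel-< (subst (Fin._< half (block s x)) hu′≡hv′ hu′<hu))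

  -- Signs of comparisons and the forbidden order patterns.

  signTri : ∀ {A B C : Set} → Tri A B C → ℤ
  signTri (tri< _ _ _) = 1ℤ
  signTri (tri≈ _ _ _) = 0ℤ
  signTri (tri> _ _ _) = -1ℤ

  sign : Fin m → Fin m → ℤ
  sign x y = signTri (Finₚ.<-cmp x y)

  sign-< : {x y : Fin m} → x Fin.< y → sign x y ≡ 1ℤ
  sign-< {x = x} {y} x<y with Finₚ.<-cmp x y
  ... | tri< _ _ _   = refl
  ... | tri≈ x≮y _ _ = contradiction x<y x≮y
  ... | tri> x≮y _ _ = contradiction x<y x≮y

  sign-refl : (x : Fin m) → sign x x ≡ 0ℤ
  sign-refl x with Finₚ.<-cmp x x
  ... | tri< _ x≢x _ = contradiction refl x≢x
  ... | tri≈ _ _ _   = refl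
  ... | tri> _ x≢x _ = contradiction refl x≢x

  sign-square : (x y : Fin m) → x ≢ y → sign x y * sign x y ≡ 1ℤ
  sign-square x y x≢y with Finₚ.<-cmp x y
  ... | tri< _ _ _   = refl
  ... | tri≈ _ x≡y _ = contradiction x≡y x≢y
  ... | tri> _ _ _   = refl

  sign-square-≤1 : (x y : Fin m) → sign x y * sign x y ≤ 1ℤ
  sign-square-≤1 x y with Finₚ.<-cmp x y
  ... | tri< _ _ _ = ℤₚ.≤-refl
  ... | tri≈ _ _ _ = +≤+ z≤n
  ... | tri> _ _ _ = ℤₚ.≤-refl

  -- The last four conditions exclude C₄^{1243} for each choice of the first edge.
  record NonExtremal (x y x′ y′ : Fin m) : Set where
    field
      x≢x′ : x ≢ x′
      y≢y′ : y ≢ y′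
      x≢y : x ≢ y
      x′≢y′ : x′ ≢ y′
      ¬xy  : ¬ Extremal x y x′ y′
      ¬x′y′ : ¬ Extremal x′ y′ x y
      ¬yx  : ¬ Extremal y x y′ x′
      ¬y′x′ : ¬ Extremal y′ x′ y x

  -- Both products are 1 or -1, so only two products equal to 1 could violate the bound. Then a and
  -- c meet b and d in the same order, while b and d are both up or both down; each of these four
  -- patterns is one of the excluded extremal ones.
  sign-products : {x y x′ y′ : Fin m} → NonExtremal x y x′ y′ →
    sign x x′ * sign y y′ + sign x y * sign x′ y′ ≤ 0ℤ
  sign-products {x = x} {y} {x′} {y′} ne
    with Finₚ.<-cmp x x′ | Finₚ.<-cmp y y′ | Finₚ.<-cmp x y | Finₚ.<-cmp x′ y′
  ... | tri≈ _ eq _ | _ | _ | _ = contradiction eq (NonExtremal.x≢x′ ne)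
  ... | _ | tri≈ _ eq _ | _ | _ = contradiction eq (NonExtremal.y≢y′ ne)
  ... | _ | _ | tri≈ _ eq _ | _ = contradiction eq (NonExtremal.x≢y ne)
  ... | _ | _ | _ | tri≈ _ eq _ = contradiction eq (NonExtremal.x′≢y′ ne)
  ... | tri< p _ _ | tri< q _ _ | tri< r _ _ | tri< t _ _ = contradiction (r , p , q , t) (NonExtremal.¬xy ne)
  ... | tri< p _ _ | tri< q _ _ | tri> _ _ r | tri> _ _ t = contradiction (r , q , p , t) (NonExtremal.¬yx ne)
  ... | tri> _ _ p | tri> _ _ q | tri< r _ _ | tri< t _ _ = contradiction (t , p , q , r) (NonExtremal.¬x′y′ ne)
  ... | tri> _ _ p | tri> _ _ q | tri> _ _ r | tri> _ _ t = contradiction (t , q , p , r) (NonExtremal.¬y′x′ ne)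
  ... | tri< _ _ _ | tri< _ _ _ | tri< _ _ _ | tri> _ _ _ = ℤₚ.≤-refl
  ... | tri< _ _ _ | tri< _ _ _ | tri> _ _ _ | tri< _ _ _ = ℤₚ.≤-refl
  ... | tri> _ _ _ | tri> _ _ _ | tri< _ _ _ | tri> _ _ _ = ℤₚ.≤-refl
  ... | tri> _ _ _ | tri> _ _ _ | tri> _ _ _ | tri< _ _ _ = ℤₚ.≤-refl
  ... | tri< _ _ _ | tri> _ _ _ | tri< _ _ _ | tri< _ _ _ = ℤₚ.≤-refl
  ... | tri< _ _ _ | tri> _ _ _ | tri> _ _ _ | tri> _ _ _ = ℤₚ.≤-refl
  ... | tri> _ _ _ | tri< _ _ _ | tri< _ _ _ | tri< _ _ _ = ℤₚ.≤-refl
  ... | tri> _ _ _ | tri< _ _ _ | tri> _ _ _ | tri> _ _ _ = ℤₚ.≤-refl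
  ... | tri< _ _ _ | tri> _ _ _ | tri< _ _ _ | tri> _ _ _ = -≤+
  ... | tri< _ _ _ | tri> _ _ _ | tri> _ _ _ | tri< _ _ _ = -≤+
  ... | tri> _ _ _ | tri< _ _ _ | tri< _ _ _ | tri> _ _ _ = -≤+
  ... | tri> _ _ _ | tri< _ _ _ | tri> _ _ _ | tri< _ _ _ = -≤+

  -- Extension by 0 to non-edges, and the pointwise inequality at one level.

  lift₂ : (Fin m → Fin m → ℤ) → Maybe (Fin m) → Maybe (Fin m) → ℤ
  lift₂ f (just x) (just y) = f x y
  lift₂ f _        _        = 0ℤ

  present : Maybe (Fin m) → ℤ
  present (just _) = 1ℤ
  present nothing  = 0ℤ

  -- In ε, σ, τ and key₂ the arguments are T(ab) and T(cb) for vertices a, b, c;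
  -- in φ they are T(ab) and T(ad).
  ε : Maybe (Fin m) → Maybe (Fin m) → ℤ
  ε = lift₂ sign

  σ : ℕ → Maybe (Fin m) → Maybe (Fin m) → ℤ
  σ s = lift₂ (λ x y → ⟦ split? s x y ⟧)

  τ : ℕ → Maybe (Fin m) → Maybe (Fin m) → ℤ
  τ s t u = ε t u - σ s t u

  -- The key 0 is reserved for non-edges.
  key : ℕ → Maybe (Fin m) → Fin (suc m)
  key s (just x) = suc (block s x)
  key s nothing  = zero

  φ : ℕ → Maybe (Fin m) → Maybe (Fin m) → ℤ
  φ s t t′ = δ (key s t) (key s t′) * ε t t′

  key₂ : ℕ → Maybe (Fin m) → Maybe (Fin m) → Fin (suc m ℕ.* suc m)
  key₂ s t u = combine (key s t) (key s u)

  δ-key₂ : ∀ s (t u t′ u′ : Maybe (Fin m)) →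
    δ (key₂ s t u) (key₂ s t′ u′) ≡ δ (key s t) (key s t′) * δ (key s u) (key s u′)
  δ-key₂ s t u t′ u′ with key s t Finₚ.≟ key s t′ | key s u Finₚ.≟ key s u′
  ... | yes p | yes q = ⟦⟧-true (key₂ s t u Finₚ.≟ key₂ s t′ u′) (cong₂ combine p q)
  ... | yes _ | no ¬q = ⟦⟧-false (key₂ s t u Finₚ.≟ key₂ s t′ u′)
                          (λ eq → ¬q (proj₂ (Finₚ.combine-injective (key s t) (key s u) (key s t′) (key s u′) eq)))
  ... | no ¬p | d     = trans (⟦⟧-false (key₂ s t u Finₚ.≟ key₂ s t′ u′)
                          (λ eq → ¬p (proj₁ (Finₚ.combine-injective (key s t) (key s u) (key s t′) (key s u′) eq))))
                          (sym (ℤₚ.*-zeroˡ ⟦ d ⟧))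

  -- Being split depends on the two blocks only, so both pairs are split or neither is. In the first
  -- case both signs are 1 and `τ` vanishes; in the second `σ` vanishes and `τ` is the sign.
  στ-same-class : ∀ s {x y x′ y′ : Fin m} → block s x ≡ block s x′ → block s y ≡ block s y′ →
    σ s (just x) (just y) * σ s (just x′) (just y′) + τ s (just x) (just y) * τ s (just x′) (just y′) ≡
    sign x y * sign x′ y′
  στ-same-class s {x} {y} {x′} {y′} bx by with split? s x y | split? s x′ y′
  ... | yes sp | yes sp′ rewrite sign-< (Split⇒< s sp) | sign-< (Split⇒< s sp′) = refl
  ... | yes (lt , eq) | no ¬sp′ = contradiction
    (subst₂ Fin._<_ bx by lt , trans (cong half (sym bx)) (trans eq (cong half by))) ¬sp′
  ... | no ¬sp | yes (lt , eq) = contradiction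
    (subst₂ Fin._<_ (sym bx) (sym by) lt , trans (cong half bx) (trans eq (cong half (sym by)))) ¬sp
  ... | no _ | no _ = drop-zeros (sign x y) (sign x′ y′)
    where
    drop-zeros : ∀ e e′ → 0ℤ * 0ℤ + (e - 0ℤ) * (e′ - 0ℤ) ≡ e * e′
    drop-zeros = solve-∀

  σσ-other-class : ∀ s {x y x′ y′ : Fin m} → NonExtremal x y x′ y′ →
    ¬ (block s x ≡ block s x′ × block s y ≡ block s y′) →
    σ s (just x) (just y) * σ s (just x′) (just y′) ≡ 0ℤ
  σσ-other-class s {x} {y} {x′} {y′} ne ¬same with split? s x y | split? s x′ y′
  ... | yes sp | yes sp′ = contradiction (Split-unique s (NonExtremal.¬xy ne) (NonExtremal.¬x′y′ ne) sp sp′) ¬same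
  ... | yes _  | no _    = refl
  ... | no _   | yes _   = refl
  ... | no _   | no _    = refl

  -- If both keys agree, the three summands collapse to the two products of `sign-products`. If a
  -- key differs, the `φ` product and the key kernel vanish, and so does the `σ` product because
  -- split pairs form a single group.
  pointwise-just : ∀ s {x y x′ y′ : Fin m} → NonExtremal x y x′ y′ →
    φ s (just x) (just x′) * φ s (just y) (just y′)
      + (σ s (just x) (just y) * σ s (just x′) (just y′)
         + δ (key₂ s (just x) (just y)) (key₂ s (just x′) (just y′))
           * (τ s (just x) (just y) * τ s (just x′) (just y′))) ≤ 0ℤ
  pointwise-just s {x} {y} {x′} {y′} ne
    rewrite δ-key₂ s (just x) (just y) (just x′) (just y′)
    with key s (just x) Finₚ.≟ key s (just x′) | key s (just y) Finₚ.≟ key s (just y′)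
  ... | yes p | yes q = subst (_≤ 0ℤ) (sym eq) (sign-products ne)
    where
    open ≡-Reasoning
    σσ = σ s (just x) (just y) * σ s (just x′) (just y′)
    ττ = τ s (just x) (just y) * τ s (just x′) (just y′)
    drop-ones : ∀ e e′ a b → (1ℤ * e) * (1ℤ * e′) + (a + (1ℤ * 1ℤ) * b) ≡ e * e′ + (a + b)
    drop-ones = solve-∀
    eq = begin
      (1ℤ * sign x x′) * (1ℤ * sign y y′) + (σσ + (1ℤ * 1ℤ) * ττ)
        ≡⟨ drop-ones (sign x x′) (sign y y′) σσ ττ ⟩
      sign x x′ * sign y y′ + (σσ + ττ)
        ≡⟨ cong (_+_ (sign x x′ * sign y y′)) (στ-same-class s (Finₚ.suc-injective p) (Finₚ.suc-injective q)) ⟩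
      sign x x′ * sign y y′ + sign x y * sign x′ y′ ∎
  ... | yes _ | no ¬q
    rewrite σσ-other-class s ne (λ same → ¬q (cong suc (proj₂ same))) =
      ℤₚ.≤-reflexive (vanish (sign x x′) (sign y y′) (τ s (just x) (just y) * τ s (just x′) (just y′)))
    where
    vanish : ∀ e e′ b → (1ℤ * e) * (0ℤ * e′) + (0ℤ + (1ℤ * 0ℤ) * b) ≡ 0ℤ
    vanish = solve-∀
  ... | no ¬p | d
    rewrite σσ-other-class s ne (λ same → ¬p (cong suc (proj₁ same))) =
      ℤₚ.≤-reflexive (vanish (sign x x′) ⟦ d ⟧ (sign y y′) (τ s (just x) (just y) * τ s (just x′) (just y′)))
    where
    vanish : ∀ e d e′ b → (0ℤ * e) * (d * e′) + (0ℤ + (0ℤ * d) * b) ≡ 0ℤ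
    vanish = solve-∀

  -- This is the case b = d: `φ` vanishes on equal times and the remainder is a squared sign. It
  -- makes each common neighbour cost exactly 1.
  pointwise-diagonal : ∀ s {x y : Fin m} → x ≢ y →
    φ s (just x) (just x) * φ s (just y) (just y)
      + (σ s (just x) (just y) * σ s (just x) (just y)
         + δ (key₂ s (just x) (just y)) (key₂ s (just x) (just y))
           * (τ s (just x) (just y) * τ s (just x) (just y))) ≡ 1ℤ
  pointwise-diagonal s {x} {y} x≢y = begin
    φ s (just x) (just x) * φ s (just y) (just y) + (σσ + δ κ κ * ττ)
      ≡⟨ cong₂ (λ e d → p * e * φ s (just y) (just y) + (σσ + d * ττ)) (sign-refl x) (⟦⟧-true (κ Finₚ.≟ κ) refl) ⟩
    p * 0ℤ * φ s (just y) (just y) + (σσ + 1ℤ * ττ)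
      ≡⟨ simplify p (φ s (just y) (just y)) σσ ττ ⟩
    σσ + ττ
      ≡⟨ στ-same-class s refl refl ⟩
    sign x y * sign x y
      ≡⟨ sign-square x y x≢y ⟩
    1ℤ ∎
    where
    open ≡-Reasoning
    κ = key₂ s (just x) (just y)
    p = δ (key s (just x)) (key s (just x))
    σσ = σ s (just x) (just y) * σ s (just x) (just y)
    ττ = τ s (just x) (just y) * τ s (just x) (just y)
    simplify : ∀ p f a b → p * 0ℤ * f + (a + 1ℤ * b) ≡ a + b
    simplify = solve-∀

  present-nonNeg : (t : Maybe (Fin m)) → 0ℤ ≤ present t
  present-nonNeg (just _) = +≤+ z≤n
  present-nonNeg nothing  = +≤+ z≤n

  present-≤1 : (t : Maybe (Fin m)) → present t ≤ 1ℤ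
  present-≤1 (just _) = ℤₚ.≤-refl
  present-≤1 nothing  = +≤+ z≤n

  *-nonNeg : ∀ {i j} → 0ℤ ≤ i → 0ℤ ≤ j → 0ℤ ≤ i * j
  *-nonNeg {i} 0≤i 0≤j = subst (_≤ i * _) (ℤₚ.*-zeroʳ i) (ℤₚ.*-monoˡ-≤-nonNeg i {{nonNegative 0≤i}} 0≤j)

  -- The three summands are φ_a(b,d) φ_c(b,d), the (b,d) term of N_s(a,c)², and the
  -- (b,d) term of a sum of squares over the groups: within a group either all
  -- elements are split or none is, so ε = σ + τ gives no mixed products.
  form : ℕ → (t u t′ u′ : Maybe (Fin m)) → ℤ
  form s t u t′ u′ =
    φ s t t′ * φ s u u′ + (σ s t u * σ s t′ u′ + δ (key₂ s t u) (key₂ s t′ u′) * (τ s t u * τ s t′ u′))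

  -- Each of the three summands has a factor from every one of the four entries, in the sense that
  -- it vanishes as soon as one of them is a non-edge.
  form-absent : ∀ s (t u t′ u′ : Maybe (Fin m)) → present t * present u * (present t′ * present u′) ≡ 0ℤ →
    form s t u t′ u′ ≡ 0ℤ
  form-absent s nothing u t′ u′ _ = vanish (δ (key s nothing) (key s t′)) (φ s u u′) (σ s t′ u′)
    (δ (key₂ s nothing u) (key₂ s t′ u′)) (τ s t′ u′)
    where
    vanish : ∀ d f g k h → (d * 0ℤ) * f + (0ℤ * g + k * ((0ℤ - 0ℤ) * h)) ≡ 0ℤ
    vanish = solve-∀
  form-absent s (just x) nothing t′ u′ _ = vanish (δ (key s nothing) (key s u′)) (φ s (just x) t′) (σ s t′ u′)
    (δ (key₂ s (just x) nothing) (key₂ s t′ u′)) (τ s t′ u′)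
    where
    vanish : ∀ d f g k h → f * (d * 0ℤ) + (0ℤ * g + k * ((0ℤ - 0ℤ) * h)) ≡ 0ℤ
    vanish = solve-∀
  form-absent s (just x) (just y) nothing u′ _ = vanish (δ (key s (just x)) (key s nothing)) (φ s (just y) u′) (σ s (just x) (just y))
    (δ (key₂ s (just x) (just y)) (key₂ s nothing u′)) (τ s (just x) (just y))
    where
    vanish : ∀ d f g k h → (d * 0ℤ) * f + (g * 0ℤ + k * (h * (0ℤ - 0ℤ))) ≡ 0ℤ
    vanish = solve-∀
  form-absent s (just x) (just y) (just x′) nothing _ = vanish (δ (key s (just y)) (key s nothing)) (φ s (just x) (just x′)) (σ s (just x) (just y))
    (δ (key₂ s (just x) (just y)) (key₂ s (just x′) nothing)) (τ s (just x) (just y))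
    where
    vanish : ∀ d f g k h → f * (d * 0ℤ) + (g * 0ℤ + k * (h * (0ℤ - 0ℤ))) ≡ 0ℤ
    vanish = solve-∀

  -- This controls the terms with a = c, where `free` says nothing; they sum to at most a squared
  -- degree.
  φ-square : ∀ s (t t′ : Maybe (Fin m)) → φ s t t′ * φ s t t′ ≤ present t * present t′
  φ-square s nothing  t′       = ℤₚ.≤-reflexive (vanish (δ (key s nothing) (key s t′)) (present t′))
    where
    vanish : ∀ d p → (d * 0ℤ) * (d * 0ℤ) ≡ 0ℤ * p
    vanish = solve-∀
  φ-square s (just x) nothing  = +≤+ z≤n
  φ-square s (just x) (just y) with key s (just x) Finₚ.≟ key s (just y)
  ... | yes _ = subst (_≤ 1ℤ) (drop-ones (sign x y)) (sign-square-≤1 x y)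
    where
    drop-ones : ∀ e → e * e ≡ (1ℤ * e) * (1ℤ * e)
    drop-ones = solve-∀
  ... | no _  = +≤+ z≤n

  σ-self : ∀ s (t : Maybe (Fin m)) → σ s t t ≡ 0ℤ
  σ-self s nothing  = refl
  σ-self s (just x) = ⟦⟧-false (split? s x x) (λ sp → ℕₚ.<-irrefl refl (proj₁ sp))

  -- Double sums, iterated Cauchy-Schwarz and a quadratic inequality.

  ∑∑-distrib-+ : (f g : Fin n → Fin k → ℤ) →
    ∑[ i < n ] ∑[ j < k ] (f i j + g i j) ≡ ∑[ i < n ] ∑[ j < k ] f i j + ∑[ i < n ] ∑[ j < k ] g i j
  ∑∑-distrib-+ f g = trans (sum-cong-≗ (λ i → ∑-distrib-+ (f i) (g i))) (∑-distrib-+ (λ i → sum (f i)) (λ i → sum (g i)))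

  ∑∑-mono-≤ : {f g : Fin n → Fin k → ℤ} → (∀ i j → f i j ≤ g i j) →
    ∑[ i < n ] ∑[ j < k ] f i j ≤ ∑[ i < n ] ∑[ j < k ] g i j
  ∑∑-mono-≤ f≤g = ∑-mono-≤ (λ i → ∑-mono-≤ (f≤g i))

  ∑-term-≤ : {f : Fin n → ℤ} → (∀ i → 0ℤ ≤ f i) → ∀ i → f i ≤ sum f
  ∑-term-≤ {f = f} 0≤f i = subst (_≤ sum f) (∑-δ i f) (∑-mono-≤ below)
    where
    below : ∀ j → δ i j * f j ≤ f j
    below j with i Finₚ.≟ j
    ... | yes _ = ℤₚ.≤-reflexive (ℤₚ.*-identityˡ (f j))
    ... | no _  = subst (_≤ f j) (sym (ℤₚ.*-zeroˡ (f j))) (0≤f j)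

  σ-nonNeg : ∀ s (t u : Maybe (Fin m)) → 0ℤ ≤ σ s t u
  σ-nonNeg s (just x) (just y) = ⟦⟧-nonNeg (split? s x y)
  σ-nonNeg s (just x) nothing  = +≤+ z≤n
  σ-nonNeg s nothing  u        = +≤+ z≤n

  σ-levels : ∀ l → m ℕ.≤ 2 ℕ.^ l → {x y : Fin m} → x Fin.< y →
    1ℤ ≤ ∑[ s < l ] σ (toℕ s) (just x) (just y)
  σ-levels l m≤2^l {x} {y} x<y with splitting-level l x y (ℕₚ.<-≤-trans (Finₚ.toℕ<n y) m≤2^l) x<y
  ... | s , split = subst (_≤ ∑[ s < l ] σ (toℕ s) (just x) (just y)) (⟦⟧-true (split? (toℕ s) x y) split)
                      (∑-term-≤ (λ s → σ-nonNeg (toℕ s) (just x) (just y)) s)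

  ∑-cauchy-schwarz³ : (f : Fin n → Fin n → Fin l → ℤ) →
    ∑[ a < n ] ∑[ c < n ] ∑[ s < l ] f a c s * ∑[ a < n ] ∑[ c < n ] ∑[ s < l ] f a c s ≤
    + n * (+ n * (+ l * ∑[ a < n ] ∑[ c < n ] ∑[ s < l ] (f a c s * f a c s)))
  ∑-cauchy-schwarz³ {n} {l} f = begin
    sum F * sum F
      ≤⟨ cauchy-schwarz F ⟩
    + n * sum (λ a → F a * F a)
      ≤⟨ ℤₚ.*-monoˡ-≤-nonNeg (+ n) (∑-mono-≤ (λ a → cauchy-schwarz (λ c → sum (f a c)))) ⟩
    + n * sum (λ a → + n * sum (λ c → sum (f a c) * sum (f a c)))
      ≡⟨ cong (+ n *_) (*-distribˡ-sum (+ n) (λ a → sum (λ c → sum (f a c) * sum (f a c)))) ⟨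
    + n * (+ n * sum (λ a → sum (λ c → sum (f a c) * sum (f a c))))
      ≤⟨ ℤₚ.*-monoˡ-≤-nonNeg (+ n) (ℤₚ.*-monoˡ-≤-nonNeg (+ n)
           (∑∑-mono-≤ (λ a c → cauchy-schwarz (f a c)))) ⟩
    + n * (+ n * sum (λ a → sum (λ c → + l * Q a c)))
      ≡⟨ cong (λ w → + n * (+ n * w)) (trans (*-distribˡ-sum (+ l) (λ a → sum (Q a)))
           (sum-cong-≗ (λ a → *-distribˡ-sum (+ l) (Q a)))) ⟨
    + n * (+ n * (+ l * sum (λ a → sum (Q a)))) ∎
    where
    open ℤₚ.≤-Reasoning
    F : Fin n → ℤ
    F a = sum (λ c → sum (f a c))
    Q : Fin n → Fin n → ℤ
    Q a c = sum (λ s → f a c s * f a c s)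

  square-mono-≤ : ∀ {i j} → 0ℤ ≤ i → i ≤ j → i * i ≤ j * j
  square-mono-≤ {i} {j} 0≤i i≤j = ℤₚ.≤-trans
    (ℤₚ.*-monoˡ-≤-nonNeg i {{nonNegative 0≤i}} i≤j)
    (ℤₚ.*-monoʳ-≤-nonNeg j {{nonNegative (ℤₚ.≤-trans 0≤i i≤j)}} i≤j)

  *-cancel-square : ∀ {i j} → 0ℤ ≤ i → 0ℤ ≤ j → i * i ≤ j * i → i ≤ j
  *-cancel-square {+0}        _ 0≤j _ = 0≤j
  *-cancel-square {+ (suc k)} _ _ ii≤ji = ℤₚ.*-cancelʳ-≤-pos _ _ (+ suc k) ii≤ji

  -- The hypotheses give S² ≤ (2U + D)² ≤ 8U² + 2D² ≤ B S with B the claimed bound, and one factor S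
  -- cancels.
  quadratic-bound : ∀ N L S U D → 0ℤ ≤ S → S ≤ (U + U) + D → U * U ≤ N * (N * (L * (L * (S + S)))) →
    D * D ≤ N * S → 0ℤ ≤ + 16 * (N * N * (L * L)) + + 2 * N → S ≤ + 16 * (N * N * (L * L)) + + 2 * N
  quadratic-bound N L S U D 0≤S S≤ UU≤ DD≤ 0≤B = *-cancel-square 0≤S 0≤B (begin
    S * S
      ≤⟨ square-mono-≤ 0≤S S≤ ⟩
    (U + U + D) * (U + U + D)
      ≡⟨ ℤₚ.+-identityʳ _ ⟨
    (U + U + D) * (U + U + D) + 0ℤ
      -- Adding (2U - D)² removes the mixed term 4UD.
      ≤⟨ ℤₚ.+-monoʳ-≤ ((U + U + D) * (U + U + D)) (0≤i*i (U + U - D)) ⟩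
    (U + U + D) * (U + U + D) + (U + U - D) * (U + U - D)
      ≡⟨ parallelogram U D ⟩
    + 8 * (U * U) + + 2 * (D * D)
      ≤⟨ ℤₚ.+-mono-≤ (ℤₚ.*-monoˡ-≤-nonNeg (+ 8) UU≤) (ℤₚ.*-monoˡ-≤-nonNeg (+ 2) DD≤) ⟩
    + 8 * (N * (N * (L * (L * (S + S))))) + + 2 * (N * S)
      ≡⟨ collect N L S ⟩
    (+ 16 * (N * N * (L * L)) + + 2 * N) * S ∎)
    where
    open ℤₚ.≤-Reasoning
    parallelogram : ∀ U D → (U + U + D) * (U + U + D) + (U + U - D) * (U + U - D) ≡ + 8 * (U * U) + + 2 * (D * D)
    parallelogram = solve-∀
    collect : ∀ N L S → + 8 * (N * (N * (L * (L * (S + S))))) + + 2 * (N * S) ≡ (+ 16 * (N * N * (L * L)) + + 2 * N) * S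
    collect = solve-∀

  -- An edge order as a symmetric partial matrix of times. In `free` the order of the two middle
  -- edges is left open: exchanging a with b and c with d swaps them, so both orders give the same
  -- pattern.
  record TimedGraph (n m : ℕ) : Set where
    field
      time       : Fin n → Fin n → Maybe (Fin m)
      symmetric  : ∀ a b → time a b ≡ time b a
      injective  : ∀ {a b d x} → time a b ≡ just x → time a d ≡ just x → b ≡ d
      surjective : ∀ x → ∃[ a ] ∃[ b ] time a b ≡ just x
      free       : ∀ {a b c d x y x′ y′} → a ≢ c → b ≢ d →
                   time a b ≡ just x → time c b ≡ just y → time a d ≡ just x′ → time c d ≡ just y′ →
                   ¬ Extremal x y x′ y′

  -- Degrees, codegrees and the energy of one level.

  module Counting {n m : ℕ} (G : TimedGraph n m) where
    open TimedGraph G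

    distinct-far : ∀ {a b d x x′} → b ≢ d → time a b ≡ just x → time a d ≡ just x′ → x ≢ x′
    distinct-far b≢d ab ad refl = b≢d (injective ab ad)

    distinct-near : ∀ {a b c x y} → a ≢ c → time a b ≡ just x → time c b ≡ just y → x ≢ y
    distinct-near a≢c ab cb = distinct-far a≢c (trans (symmetric _ _) ab) (trans (symmetric _ _) cb)

    nonExtremal : ∀ {a b c d x y x′ y′} → a ≢ c → b ≢ d →
      time a b ≡ just x → time c b ≡ just y → time a d ≡ just x′ → time c d ≡ just y′ →
      NonExtremal x y x′ y′
    nonExtremal a≢c b≢d ab cb ad cd = record
      { x≢x′  = distinct-far b≢d ab ad
      ; y≢y′  = distinct-far b≢d cb cd
      ; x≢y   = distinct-near a≢c ab cb
      ; x′≢y′ = distinct-near a≢c ad cd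
      ; ¬xy   = free a≢c b≢d ab cb ad cd
      ; ¬x′y′ = free a≢c (≢-sym b≢d) ad cd ab cb
      ; ¬yx   = free (≢-sym a≢c) b≢d cb ab cd ad
      ; ¬y′x′ = free (≢-sym a≢c) (≢-sym b≢d) cd ad cb ab
      }

    -- Pairs b ≠ d contribute at most 0 and b = d contributes at most 1 per common neighbour, so
    -- summation over b and d leaves the codegree.
    pointwise : ∀ s {a c} → a ≢ c → ∀ b d →
      form s (time a b) (time c b) (time a d) (time c d) ≤ δ b d * (present (time a b) * present (time c b))
    pointwise s {a} {c} a≢c b d = bound _ _ _ _ refl refl refl refl
      where
      absent : ∀ t u t′ u′ → present t * present u * (present t′ * present u′) ≡ 0ℤ →
        form s t u t′ u′ ≤ δ b d * (present t * present u)
      absent t u t′ u′ eq = subst (_≤ δ b d * (present t * present u)) (sym (form-absent s t u t′ u′ eq))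
        (*-nonNeg (⟦⟧-nonNeg (b Finₚ.≟ d)) (*-nonNeg (present-nonNeg t) (present-nonNeg u)))
      bound : ∀ t u t′ u′ → time a b ≡ t → time c b ≡ u → time a d ≡ t′ → time c d ≡ u′ →
        form s t u t′ u′ ≤ δ b d * (present t * present u)
      bound nothing  u        t′        u′       _ _ _ _ = absent nothing u t′ u′ refl
      bound (just x) nothing  t′        u′       _ _ _ _ = absent (just x) nothing t′ u′ refl
      bound (just x) (just y) nothing   u′       _ _ _ _ = absent (just x) (just y) nothing u′ refl
      bound (just x) (just y) (just x′) nothing  _ _ _ _ = absent (just x) (just y) (just x′) nothing refl
      bound (just x) (just y) (just x′) (just y′) ab cb ad cd with b Finₚ.≟ d
      ... | no b≢d = pointwise-just s (nonExtremal a≢c b≢d ab cb ad cd)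
      ... | yes refl with trans (sym ab) ad | trans (sym cb) cd
      ...   | refl | refl = ℤₚ.≤-reflexive (pointwise-diagonal s (distinct-near a≢c ab cb))

    degree : Fin n → ℤ
    degree b = ∑[ a < n ] present (time a b)

    codegree : Fin n → Fin n → ℤ
    codegree a c = ∑[ b < n ] (present (time a b) * present (time c b))

    -- The (a,c) term in the expansion of the sum over b and d of (Σ_a φ_a(b,d))².
    correlation : ℕ → Fin n → Fin n → ℤ
    correlation s a c = ∑[ b < n ] ∑[ d < n ] (φ s (time a b) (time a d) * φ s (time c b) (time c d))

    -- The number N_s(a,c).
    splits : ℕ → Fin n → Fin n → ℤ
    splits s a c = ∑[ b < n ] σ s (time a b) (time c b)

    row-degree : ∀ a → ∑[ b < n ] present (time a b) ≡ degree a
    row-degree a = sum-cong-≗ (λ b → cong present (symmetric a b))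

    codegree-nonNeg : ∀ a c → 0ℤ ≤ codegree a c
    codegree-nonNeg a c = ∑-nonNeg (λ b → *-nonNeg (present-nonNeg (time a b)) (present-nonNeg (time c b)))

    off-diagonal : ∀ s {a c} → a ≢ c → correlation s a c + splits s a c * splits s a c ≤ codegree a c
    off-diagonal s {a} {c} a≢c = begin
      correlation s a c + splits s a c * splits s a c
        ≡⟨ cong (_+_ (correlation s a c)) (ℤₚ.+-identityʳ (splits s a c * splits s a c)) ⟨
      correlation s a c + (splits s a c * splits s a c + 0ℤ)
        -- The sum of squares of `τ` over the groups is added, which completes the three summands of
        -- `form`.
        ≤⟨ ℤₚ.+-monoʳ-≤ (correlation s a c) (ℤₚ.+-monoʳ-≤ (splits s a c * splits s a c)
             (key-kernel-nonNeg κ (λ b → τ s (time a b) (time c b)))) ⟩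
      correlation s a c + (splits s a c * splits s a c + kernel)
        ≡⟨ cong (λ w → correlation s a c + (w + kernel)) (∑-*-∑ sp sp) ⟩
      correlation s a c + (sum (λ b → sum (λ d → sp b * sp d)) + kernel)
        ≡⟨ cong (_+_ (correlation s a c)) (∑∑-distrib-+ (λ b d → sp b * sp d) _) ⟨
      correlation s a c + sum (λ b → sum (λ d → sp b * sp d + δ (κ b) (κ d) * (re b * re d)))
        ≡⟨ ∑∑-distrib-+ (λ b d → φ s (time a b) (time a d) * φ s (time c b) (time c d)) _ ⟨
      sum (λ b → sum (λ d → form s (time a b) (time c b) (time a d) (time c d)))
        ≤⟨ ∑∑-mono-≤ (pointwise s a≢c) ⟩
      sum (λ b → sum (λ d → δ b d * (present (time a b) * present (time c b))))
        ≡⟨ sum-cong-≗ (λ b → ∑-δ b (λ _ → present (time a b) * present (time c b))) ⟩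
      codegree a c ∎
      where
      open ℤₚ.≤-Reasoning
      κ : Fin n → _
      κ b = key₂ s (time a b) (time c b)
      sp re : Fin n → ℤ
      sp b = σ s (time a b) (time c b)
      re b = τ s (time a b) (time c b)
      kernel = sum (λ b → sum (λ d → δ (κ b) (κ d) * (re b * re d)))

    diagonal : ∀ s a → correlation s a a + splits s a a * splits s a a ≤ degree a * degree a
    diagonal s a = begin
      correlation s a a + splits s a a * splits s a a
        ≡⟨ cong (λ w → correlation s a a + w * w) (∑-zero (λ b → σ s (time a b) (time a b)) (λ b → σ-self s (time a b))) ⟩
      correlation s a a + 0ℤ
        ≡⟨ ℤₚ.+-identityʳ (correlation s a a) ⟩
      correlation s a a
        ≤⟨ ∑∑-mono-≤ (λ b d → φ-square s (time a b) (time a d)) ⟩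
      sum (λ b → sum (λ d → present (time a b) * present (time a d)))
        ≡⟨ ∑-*-∑ (λ b → present (time a b)) (λ d → present (time a d)) ⟨
      sum (λ b → present (time a b)) * sum (λ d → present (time a d))
        ≡⟨ cong₂ _*_ (row-degree a) (row-degree a) ⟩
      degree a * degree a ∎
      where open ℤₚ.≤-Reasoning

    -- One bound for all pairs: summed over a and c, the codegrees and the diagonal terms each give
    -- `squares`.
    pair-bound : ∀ s a c →
      correlation s a c + splits s a c * splits s a c ≤ codegree a c + δ a c * (degree c * degree c)
    pair-bound s a c with a Finₚ.≟ c
    ... | no a≢c   = subst (correlation s a c + splits s a c * splits s a c ≤_) (sym (trans (cong (_+_ (codegree a c)) (ℤₚ.*-zeroˡ (degree c * degree c)))
                                       (ℤₚ.+-identityʳ (codegree a c)))) (off-diagonal s a≢c)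
    ... | yes refl = subst₂ _≤_ (ℤₚ.+-identityˡ _) (cong (_+_ (codegree a a)) (sym (ℤₚ.*-identityˡ (degree a * degree a))))
                       (ℤₚ.+-mono-≤ (codegree-nonNeg a a) (diagonal s a))

    squares : ℤ
    squares = ∑[ b < n ] (degree b * degree b)

    -- Both sides count walks of length two, on the right by their middle vertex.
    ∑-codegree : ∑[ a < n ] ∑[ c < n ] codegree a c ≡ squares
    ∑-codegree = gram (λ a b → present (time a b))

    -- With the sum over b moved outside, each b leaves the Gram sum of the rows d ↦ φ_a(b,d).
    correlation-nonNeg : ∀ s → 0ℤ ≤ ∑[ a < n ] ∑[ c < n ] correlation s a c
    correlation-nonNeg s = subst (0ℤ ≤_)
      (sym (∑-rotate (λ a c b → sum (λ d → φ s (time a b) (time a d) * φ s (time c b) (time c d)))))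
      (∑-nonNeg (λ b → gram-nonNeg (λ a d → φ s (time a b) (time a d))))

    splits-energy : ∀ s → ∑[ a < n ] ∑[ c < n ] (splits s a c * splits s a c) ≤ squares + squares
    splits-energy s = begin
      sum (λ a → sum (λ c → splits s a c * splits s a c))
        ≡⟨ ℤₚ.+-identityˡ _ ⟨
      0ℤ + sum (λ a → sum (λ c → splits s a c * splits s a c))
        ≤⟨ ℤₚ.+-monoˡ-≤ (sum (λ a → sum (λ c → splits s a c * splits s a c))) (correlation-nonNeg s) ⟩
      sum (λ a → sum (λ c → correlation s a c)) + sum (λ a → sum (λ c → splits s a c * splits s a c))
        ≡⟨ ∑∑-distrib-+ (correlation s) (λ a c → splits s a c * splits s a c) ⟨
      sum (λ a → sum (λ c → correlation s a c + splits s a c * splits s a c))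
        ≤⟨ ∑∑-mono-≤ (pair-bound s) ⟩
      sum (λ a → sum (λ c → codegree a c + δ a c * (degree c * degree c)))
        ≡⟨ ∑∑-distrib-+ codegree (λ a c → δ a c * (degree c * degree c)) ⟩
      sum (λ a → sum (codegree a)) + sum (λ a → sum (λ c → δ a c * (degree c * degree c)))
        ≡⟨ cong₂ _+_ ∑-codegree (sum-cong-≗ (λ a → ∑-δ a (λ c → degree c * degree c))) ⟩
      squares + squares ∎
      where open ℤₚ.≤-Reasoning

    total-degree : ℤ
    total-degree = ∑[ b < n ] degree b

    degree-square : total-degree * total-degree ≤ + n * squares
    degree-square = cauchy-schwarz degree

    total-degree-≤ : total-degree ≤ + n * + n
    total-degree-≤ = begin
      total-degree                ≤⟨ ∑∑-mono-≤ (λ b a → present-≤1 (time a b)) ⟩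
      ∑[ b < n ] ∑[ a < n ] 1ℤ    ≡⟨ ∑-const n _ ⟩
      + n * ∑[ a < n ] 1ℤ         ≡⟨ cong (+ n *_) (trans (∑-const n 1ℤ) (ℤₚ.*-identityʳ (+ n))) ⟩
      + n * + n                   ∎
      where open ℤₚ.≤-Reasoning

    -- Each time marks one ordered pair of endpoints, and an entry of the matrix is marked only by
    -- the time it carries, hence at most once.
    edges-≤-total-degree : + m ≤ total-degree
    edges-≤-total-degree = begin
      + m
        ≡⟨ trans (∑-const m 1ℤ) (ℤₚ.*-identityʳ (+ m)) ⟨
      ∑[ i < m ] 1ℤ
        ≡⟨ sum-cong-≗ {m} (λ i → sym (trans (sum-cong-≗ {n} (λ b → ∑-δ (src i) (λ _ → δ (tgt i) b)))
             (trans (sum-cong-≗ {n} (λ b → sym (ℤₚ.*-identityʳ (δ (tgt i) b)))) (∑-δ (tgt i) (λ _ → 1ℤ))))) ⟩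
      ∑[ i < m ] ∑[ b < n ] ∑[ a < n ] (δ (src i) a * δ (tgt i) b)
        ≡⟨ ∑-rotate {n} {n} {m} (λ b a i → δ (src i) a * δ (tgt i) b) ⟨
      ∑[ b < n ] ∑[ a < n ] ∑[ i < m ] (δ (src i) a * δ (tgt i) b)
        ≤⟨ ∑∑-mono-≤ multiplicity ⟩
      total-degree ∎
      where
      open ℤₚ.≤-Reasoning
      src tgt : Fin m → Fin n
      src i = proj₁ (surjective i)
      tgt i = proj₁ (proj₂ (surjective i))
      at : Maybe (Fin m) → Fin m → ℤ
      at (just j) i = δ j i * 1ℤ
      at nothing  i = 0ℤ
      ∑-at : ∀ t → sum (at t) ≡ present t
      ∑-at (just j) = ∑-δ j (λ _ → 1ℤ)
      ∑-at nothing  = ∑-zero (at nothing) (λ _ → refl)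
      at-nonNeg : ∀ t i → 0ℤ ≤ at t i
      at-nonNeg (just j) i = *-nonNeg (⟦⟧-nonNeg (j Finₚ.≟ i)) (+≤+ z≤n)
      at-nonNeg nothing  i = +≤+ z≤n
      at-self : ∀ i → at (just i) i ≡ 1ℤ
      at-self i = cong (_* 1ℤ) (⟦⟧-true (i Finₚ.≟ i) refl)
      term : ∀ b a i → δ (src i) a * δ (tgt i) b ≤ at (time a b) i
      term b a i with src i Finₚ.≟ a | tgt i Finₚ.≟ b
      ... | yes refl | yes refl = ℤₚ.≤-reflexive
        (sym (trans (cong (λ t → at t i) (proj₂ (proj₂ (surjective i)))) (at-self i)))
      ... | yes _    | no _     = at-nonNeg (time a b) i
      ... | no _     | d        = subst (_≤ at (time a b) i) (sym (ℤₚ.*-zeroˡ ⟦ d ⟧)) (at-nonNeg (time a b) i)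
      multiplicity : ∀ b a → ∑[ i < m ] (δ (src i) a * δ (tgt i) b) ≤ present (time a b)
      multiplicity b a = ℤₚ.≤-trans (∑-mono-≤ (term b a)) (ℤₚ.≤-reflexive (∑-at (time a b)))

    -- Summation over all levels.

    module Levels (l : ℕ) (m≤2^l : m ℕ.≤ 2 ℕ.^ l) where

      ups : Fin n → Fin n → ℤ
      ups a c = ∑[ s < l ] splits (toℕ s) a c

      -- For a ≠ c the two times at b differ, so some level splits them in one order or the other.
      -- For a = c the last term alone suffices.
      cherry : ∀ a c b → present (time a b) * present (time c b) ≤
        (∑[ s < l ] σ (toℕ s) (time a b) (time c b) + ∑[ s < l ] σ (toℕ s) (time c b) (time a b))
          + δ a c * present (time c b)
      cherry a c b = bound (time a b) (time c b) refl refl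
        where
        levels : Maybe (Fin m) → Maybe (Fin m) → ℤ
        levels t u = ∑[ s < l ] σ (toℕ s) t u
        levels-nonNeg : ∀ t u → 0ℤ ≤ levels t u
        levels-nonNeg t u = ∑-nonNeg {l} {λ s → σ (toℕ s) t u} (λ s → σ-nonNeg (toℕ s) t u)
        0≤rhs : ∀ t u → 0ℤ ≤ (levels t u + levels u t) + δ a c * present u
        0≤rhs t u = ℤₚ.+-mono-≤ (ℤₚ.+-mono-≤ (levels-nonNeg t u) (levels-nonNeg u t))
                      (*-nonNeg (⟦⟧-nonNeg (a Finₚ.≟ c)) (present-nonNeg u))
        bound : ∀ t u → time a b ≡ t → time c b ≡ u →
          present t * present u ≤ (levels t u + levels u t) + δ a c * present u
        bound nothing  u        _ _ = subst (_≤ (levels nothing u + levels u nothing) + δ a c * present u)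
          (sym (ℤₚ.*-zeroˡ (present u))) (0≤rhs nothing u)
        bound (just x) nothing  _ _ = 0≤rhs (just x) nothing
        bound (just x) (just y) ab cb with a Finₚ.≟ c
        ... | yes refl = ℤₚ.+-mono-≤ (ℤₚ.+-mono-≤ (levels-nonNeg (just x) (just y)) (levels-nonNeg (just y) (just x)))
                           ℤₚ.≤-refl
        ... | no a≢c with Finₚ.<-cmp x y
        ...   | tri< x<y _ _ = ℤₚ.+-mono-≤ (ℤₚ.+-mono-≤ (σ-levels l m≤2^l x<y) (levels-nonNeg (just y) (just x))) ℤₚ.≤-refl
        ...   | tri≈ _ x≡y _ = contradiction x≡y (distinct-near a≢c ab cb)
        ...   | tri> _ _ y<x = ℤₚ.+-mono-≤ (ℤₚ.+-mono-≤ (levels-nonNeg (just x) (just y)) (σ-levels l m≤2^l y<x)) ℤₚ.≤-refl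

      codegree-bound : ∀ a c → codegree a c ≤ (ups a c + ups c a) + δ a c * degree c
      codegree-bound a c = begin
        codegree a c
          ≤⟨ ∑-mono-≤ (cherry a c) ⟩
        sum (λ b → (up a c b + up c a b) + δ a c * present (time c b))
          ≡⟨ ∑-distrib-+ (λ b → up a c b + up c a b) (λ b → δ a c * present (time c b)) ⟩
        sum (λ b → up a c b + up c a b) + sum (λ b → δ a c * present (time c b))
          ≡⟨ cong₂ _+_ (trans (∑-distrib-+ (up a c) (up c a)) (cong₂ _+_ (exchange a c) (exchange c a)))
               (trans (sym (*-distribˡ-sum (δ a c) (λ b → present (time c b)))) (cong (δ a c *_) (row-degree c))) ⟩
        (ups a c + ups c a) + δ a c * degree c ∎
        where
        open ℤₚ.≤-Reasoning
        up : Fin n → Fin n → Fin n → ℤ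
        up a c b = ∑[ s < l ] σ (toℕ s) (time a b) (time c b)
        exchange : ∀ a c → sum (up a c) ≡ ups a c
        exchange a c = ∑-comm {n} {l} (λ b s → σ (toℕ s) (time a b) (time c b))

      total-ups : ℤ
      total-ups = ∑[ a < n ] ∑[ c < n ] ups a c

      squares-bound : squares ≤ (total-ups + total-ups) + total-degree
      squares-bound = begin
        squares
          ≡⟨ ∑-codegree ⟨
        sum (λ a → sum (codegree a))
          ≤⟨ ∑∑-mono-≤ codegree-bound ⟩
        sum (λ a → sum (λ c → (ups a c + ups c a) + δ a c * degree c))
          ≡⟨ ∑∑-distrib-+ (λ a c → ups a c + ups c a) (λ a c → δ a c * degree c) ⟩
        sum (λ a → sum (λ c → ups a c + ups c a)) + sum (λ a → sum (λ c → δ a c * degree c))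
          ≡⟨ cong₂ _+_ (trans (∑∑-distrib-+ ups (λ a c → ups c a)) (cong (_+_ total-ups) (∑-comm (λ a c → ups c a))))
               (sum-cong-≗ (λ a → ∑-δ a degree)) ⟩
        (total-ups + total-ups) + total-degree ∎
        where open ℤₚ.≤-Reasoning

      -- One factor `+ l` comes from Cauchy-Schwarz over the triples (a,c,s), the other from adding
      -- up the energy bound over the `l` levels.
      ups-square : total-ups * total-ups ≤ + n * (+ n * (+ l * (+ l * (squares + squares))))
      ups-square = begin
        total-ups * total-ups
          ≤⟨ ∑-cauchy-schwarz³ {n} {l} (λ a c s → splits (toℕ s) a c) ⟩
        + n * (+ n * (+ l * sum (λ a → sum (λ c → sum {l} (λ s → splits (toℕ s) a c * splits (toℕ s) a c)))))
          ≡⟨ cong (λ w → + n * (+ n * (+ l * w))) (∑-rotate {n} {n} {l} (λ a c s → splits (toℕ s) a c * splits (toℕ s) a c)) ⟩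
        + n * (+ n * (+ l * sum {l} (λ s → sum (λ a → sum (λ c → splits (toℕ s) a c * splits (toℕ s) a c)))))
          ≤⟨ ℤₚ.*-monoˡ-≤-nonNeg (+ n) (ℤₚ.*-monoˡ-≤-nonNeg (+ n) (ℤₚ.*-monoˡ-≤-nonNeg (+ l)
               (∑-mono-≤ {l} (λ s → splits-energy (toℕ s))))) ⟩
        + n * (+ n * (+ l * sum {l} (λ s → squares + squares)))
          ≡⟨ cong (λ w → + n * (+ n * (+ l * w))) (∑-const l (squares + squares)) ⟩
        + n * (+ n * (+ l * (+ l * (squares + squares)))) ∎
        where open ℤₚ.≤-Reasoning

      edges-square : m ℕ.* m ℕ.≤ n ℕ.* (16 ℕ.* (n ℕ.* n ℕ.* (l ℕ.* l)) ℕ.+ 2 ℕ.* n)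
      edges-square = ℤₚ.drop‿+≤+ (begin
        + (m ℕ.* m)
          ≡⟨ ℤₚ.pos-* m m ⟩
        + m * + m
          ≤⟨ square-mono-≤ (+≤+ z≤n) edges-≤-total-degree ⟩
        total-degree * total-degree
          ≤⟨ degree-square ⟩
        + n * squares
          ≤⟨ ℤₚ.*-monoˡ-≤-nonNeg (+ n) (quadratic-bound (+ n) (+ l) squares total-ups total-degree
               (∑-nonNeg (λ b → 0≤i*i (degree b)))
               squares-bound ups-square degree-square bound-pos) ⟩
        + n * (+ 16 * (+ n * + n * (+ l * + l)) + + 2 * + n)
          ≡⟨ cong (+ n *_) pos-bound ⟨
        + n * + (16 ℕ.* (n ℕ.* n ℕ.* (l ℕ.* l)) ℕ.+ 2 ℕ.* n)
          ≡⟨ ℤₚ.pos-* n _ ⟨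
        + (n ℕ.* (16 ℕ.* (n ℕ.* n ℕ.* (l ℕ.* l)) ℕ.+ 2 ℕ.* n)) ∎)
        where
        open ℤₚ.≤-Reasoning
        pos-bound : + (16 ℕ.* (n ℕ.* n ℕ.* (l ℕ.* l)) ℕ.+ 2 ℕ.* n) ≡ + 16 * (+ n * + n * (+ l * + l)) + + 2 * + n
        pos-bound = cong₂ _+_
          (trans (ℤₚ.pos-* 16 (n ℕ.* n ℕ.* (l ℕ.* l))) (cong (+ 16 *_)
            (trans (ℤₚ.pos-* (n ℕ.* n) (l ℕ.* l)) (cong₂ _*_ (ℤₚ.pos-* n n) (ℤₚ.pos-* l l)))))
          (ℤₚ.pos-* 2 n)
        bound-pos : 0ℤ ≤ + 16 * (+ n * + n * (+ l * + l)) + + 2 * + n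
        bound-pos = subst (0ℤ ≤_) pos-bound (+≤+ z≤n)

open ℤ-Counting using (Extremal; TimedGraph; module Counting)
open import Data.Nat using (_+_; _≤_; _*_; _^_)

-- Edges of an edge list and their endpoints.

Unique⇒lookup-injective : ∀ {A : Set} {xs : List A} → Unique xs → ∀ i j → lookup xs i ≡ lookup xs j → i ≡ j
Unique⇒lookup-injective {xs = x ∷ xs} _          zero    zero    _  = refl
Unique⇒lookup-injective {xs = x ∷ xs} (x∉ ∷ _)   zero    (suc j) eq = contradiction eq (All.lookup x∉ (∈-lookup j))
Unique⇒lookup-injective {xs = x ∷ xs} (x∉ ∷ _)   (suc i) zero    eq = contradiction (sym eq) (All.lookup x∉ (∈-lookup i))
Unique⇒lookup-injective {xs = x ∷ xs} (_ ∷ uniq) (suc i) (suc j) eq = cong suc (Unique⇒lookup-injective uniq i j eq)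

joins? : (e : Edge n) (a b : Fin n) → Dec (Joins e a b)
joins? (u , v) a b = ((u Finₚ.≟ a) ×-dec (v Finₚ.≟ b)) ⊎-dec ((u Finₚ.≟ b) ×-dec (v Finₚ.≟ a))

Joins-sym : {e : Edge n} {a b : Fin n} → Joins e a b → Joins e b a
Joins-sym = swap

Joins-irrefl : {e : Edge n} {a b : Fin n} → WellFormed e → Joins e a b → a ≢ b
Joins-irrefl u<v (inj₁ (refl , refl)) refl = ℕₚ.<-irrefl refl u<v
Joins-irrefl u<v (inj₂ (refl , refl)) refl = ℕₚ.<-irrefl refl u<v

-- Well-formed edges list the smaller endpoint first, which rules out the two opposite orientations.
Joins-unique : {e e′ : Edge n} {a b : Fin n} → WellFormed e → WellFormed e′ → Joins e a b → Joins e′ a b → e ≡ e′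
Joins-unique _   _     (inj₁ (refl , refl)) (inj₁ (refl , refl)) = refl
Joins-unique _   _     (inj₂ (refl , refl)) (inj₂ (refl , refl)) = refl
Joins-unique u<v u′<v′ (inj₁ (refl , refl)) (inj₂ (refl , refl)) = contradiction u<v (ℕₚ.<-asym u′<v′)
Joins-unique u<v u′<v′ (inj₂ (refl , refl)) (inj₁ (refl , refl)) = contradiction u<v (ℕₚ.<-asym u′<v′)

Joins-functional : {e : Edge n} {a b d : Fin n} → Joins e a b → Joins e a d → b ≡ d
Joins-functional (inj₁ (refl , refl)) (inj₁ (_ , refl))    = refl
Joins-functional (inj₂ (refl , refl)) (inj₂ (refl , _))    = refl
Joins-functional (inj₁ (refl , refl)) (inj₂ (refl , refl)) = refl
Joins-functional (inj₂ (refl , refl)) (inj₁ (refl , refl)) = refl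

Joins-cross : {e : Edge n} {a b c d : Fin n} → a ≢ c → Joins e c b → Joins e a d → c ≡ d
Joins-cross a≢c (inj₁ (refl , _)) (inj₁ (refl , _)) = contradiction refl a≢c
Joins-cross _   (inj₁ (refl , _)) (inj₂ (refl , _)) = refl
Joins-cross _   (inj₂ (_ , refl)) (inj₁ (_ , refl)) = refl
Joins-cross a≢c (inj₂ (_ , refl)) (inj₂ (_ , refl)) = contradiction refl a≢c

-- From a duplicate-free edge list to a matrix of times.

module FromEdgeList (G : EdgeOrderedGraph n) (C4-free : ¬ ContainsC4-1243 G) where

  edge : Pos G → Edge n
  edge = lookup (edges G)

  wellFormed : ∀ i → WellFormed (edge i)
  wellFormed i = All.lookup (proper G) (∈-lookup i)

  irrefl : ∀ {a b} i → Joins (edge i) a b → a ≢ b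
  irrefl i = Joins-irrefl (wellFormed i)

  position : ∀ a b → Dec (∃[ i ] Joins (edge i) a b)
  position a b = Finₚ.any? (λ i → joins? (edge i) a b)

  position-unique : ∀ {a b} i j → Joins (edge i) a b → Joins (edge j) a b → i ≡ j
  position-unique i j ab ab′ =
    Unique⇒lookup-injective (unique G) i j (Joins-unique (wellFormed i) (wellFormed j) ab ab′)

  time : Fin n → Fin n → Maybe (Pos G)
  time a b with position a b
  ... | yes (i , _) = just i
  ... | no _        = nothing

  time⇒Joins : ∀ a b {i} → time a b ≡ just i → Joins (edge i) a b
  time⇒Joins a b eq with position a b
  time⇒Joins a b refl | yes (_ , ab) = ab

  Joins⇒time : ∀ a b {i} → Joins (edge i) a b → time a b ≡ just i
  Joins⇒time a b {i} ab with position a b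
  ... | yes (j , ab′) = cong just (position-unique j i ab′ ab)
  ... | no ¬ab        = contradiction (i , ab) ¬ab

  time-sym : ∀ a b → time a b ≡ time b a
  time-sym a b with time a b in ab | time b a in ba
  ... | nothing | nothing = refl
  ... | just i  | _       = trans (sym (Joins⇒time b a (Joins-sym (time⇒Joins a b ab)))) ba
  ... | nothing | just i  = trans (sym ab) (Joins⇒time a b (Joins-sym (time⇒Joins b a ba)))

  -- The order of the middle edges cb and ad decides which labelling of the cycle is the forbidden
  -- copy: a b c d if cb comes first, the reflected b a d c if ad does.
  ¬extremal : ∀ {a b c d x y x′ y′} → a ≢ c → b ≢ d →
    Joins (edge x) a b → Joins (edge y) c b → Joins (edge x′) a d → Joins (edge y′) c d →
    ¬ Extremal x y x′ y′
  ¬extremal {a} {b} {c} {d} {x} {y} {x′} {y′} a≢c b≢d ab cb ad cd (x<y , x<x′ , y<y′ , x′<y′)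
    with Finₚ.<-cmp y x′
  ... | tri< y<x′ _ _ = C4-free (a , b , c , d ,
    (irrefl x ab , a≢c , irrefl x′ ad , ≢-sym (irrefl y cb) , b≢d , irrefl y′ cd) ,
    x , y , y′ , x′ , ab , Joins-sym cb , cd , Joins-sym ad , x<y , y<x′ , x′<y′)
  ... | tri> _ _ x′<y = C4-free (b , a , d , c ,
    (≢-sym (irrefl x ab) , b≢d , ≢-sym (irrefl y cb) , irrefl x′ ad , a≢c , ≢-sym (irrefl y′ cd)) ,
    x , x′ , y′ , y , Joins-sym ab , ad , Joins-sym cd , cb , x<x′ , x′<y , y<y′)
  -- Were cb and ad one edge, a ≠ c would force c = d, against the edge cd.
  ... | tri≈ _ refl _ = irrefl y′ cd (Joins-cross a≢c cb ad)

  timedGraph : TimedGraph n (∣E∣ G)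
  timedGraph = record
    { time       = time
    ; symmetric  = time-sym
    ; injective  = λ {a} {b} {d} ab ad →
        Joins-functional (time⇒Joins a b ab) (time⇒Joins a d ad)
    ; surjective = λ i → proj₁ (edge i) , proj₂ (edge i) , Joins⇒time _ _ (inj₁ (refl , refl))
    ; free       = λ {a} {b} {c} {d} a≢c b≢d ab cb ad cd →
        ¬extremal a≢c b≢d (time⇒Joins a b ab) (time⇒Joins c b cb) (time⇒Joins a d ad) (time⇒Joins c d cd)
    }

-- Logarithms and the final constants.

n<2^[1+⌊log₂n⌋] : ∀ n → n ℕ.< 2 ^ suc ⌊log₂ n ⌋
n<2^[1+⌊log₂n⌋] n = ℕₚ.≰⇒> λ 2^≤n →
  ℕₚ.1+n≰n (subst (_≤ ⌊log₂ n ⌋) (⌊log₂[2^n]⌋≡n (suc ⌊log₂ n ⌋)) (⌊log₂⌋-mono-≤ 2^≤n))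

-- This crude bound serves to show that O(log n) levels suffice.
edges-≤-n*n : (G : TimedGraph n m) → m ≤ n * n
edges-≤-n*n {n} {m} G = ℤₚ.drop‿+≤+ (subst (+ m ℤ.≤_) (sym (ℤₚ.pos-* n n)) (ℤₚ.≤-trans edges-≤-total-degree total-degree-≤))
  where open Counting G

theorem5p1 : ∃[ C ] ∃[ N ] ∀ (n : ℕ) → N ≤ n → (G : EdgeOrderedGraph n) →
    ¬ ContainsC4-1243 G → ∣E∣ G ^ 2 ≤ C * n ^ 3 * ⌊log₂ n ⌋ ^ 2
-- With `g` the logarithm, at most 4g levels occur, so 16 (4g)² + 2 g² = 258 g². The threshold 2
-- ensures 1 ≤ g.
theorem5p1 = 258 , 2 , bound
  where
  bound : ∀ n → 2 ≤ n → (G : EdgeOrderedGraph n) → ¬ ContainsC4-1243 G → ∣E∣ G ^ 2 ≤ 258 * n ^ 3 * ⌊log₂ n ⌋ ^ 2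
  bound n 2≤n G C4-free = begin
    e ^ 2
      ≡⟨ cong (e *_) (ℕₚ.*-identityʳ e) ⟩
    e * e
      -- There are at most n² edges and n < 2^h, so 2h levels are enough.
      ≤⟨ Counting.Levels.edges-square T (h + h) e≤2^[h+h] ⟩
    n * (16 * (n * n * ((h + h) * (h + h))) + 2 * n)
      ≤⟨ ℕₚ.*-monoʳ-≤ n (ℕₚ.+-mono-≤
           (ℕₚ.*-monoʳ-≤ 16 (ℕₚ.*-monoʳ-≤ (n * n) (ℕₚ.*-mono-≤ (ℕₚ.+-mono-≤ h≤2g h≤2g) (ℕₚ.+-mono-≤ h≤2g h≤2g))))
           (ℕₚ.*-monoʳ-≤ 2 n≤n*n*g*g)) ⟩
    n * (16 * (n * n * ((g + g + (g + g)) * (g + g + (g + g)))) + 2 * (n * n * (g * g)))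
      ≡⟨ collect n g ⟩
    258 * n ^ 3 * g ^ 2 ∎
    where
    open ℕₚ.≤-Reasoning
    e = ∣E∣ G
    T = FromEdgeList.timedGraph G C4-free
    g = ⌊log₂ n ⌋
    h = suc g
    1≤g : 1 ≤ g
    1≤g = subst (_≤ g) (⌊log₂[2^n]⌋≡n 1) (⌊log₂⌋-mono-≤ 2≤n)
    h≤2g : h ≤ g + g
    h≤2g = ℕₚ.+-monoˡ-≤ g 1≤g
    e≤2^[h+h] : e ≤ 2 ^ (h + h)
    e≤2^[h+h] = begin
      e              ≤⟨ edges-≤-n*n T ⟩
      n * n          ≤⟨ ℕₚ.*-mono-≤ n≤2^h n≤2^h ⟩
      2 ^ h * 2 ^ h  ≡⟨ ℕₚ.^-distribˡ-+-* 2 h h ⟨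
      2 ^ (h + h)    ∎
      where
      n≤2^h = ℕₚ.<⇒≤ (n<2^[1+⌊log₂n⌋] n)
    n≤n*n*g*g : n ≤ n * n * (g * g)
    n≤n*n*g*g = begin
      n                ≡⟨ ℕₚ.*-identityʳ n ⟨
      n * 1            ≤⟨ ℕₚ.*-monoʳ-≤ n (ℕₚ.≤-trans (s≤s z≤n) 2≤n) ⟩
      n * n            ≡⟨ ℕₚ.*-identityʳ (n * n) ⟨
      n * n * 1        ≤⟨ ℕₚ.*-monoʳ-≤ (n * n) (ℕₚ.*-mono-≤ 1≤g 1≤g) ⟩
      n * n * (g * g)  ∎
    collect : ∀ n g → n * (16 * (n * n * ((g + g + (g + g)) * (g + g + (g + g)))) + 2 * (n * n * (g * g))) ≡
      258 * (n * (n * (n * 1))) * (g * (g * 1))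
    collect = ℕ-Solver.solve-∀
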